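{- For each of the following sets $P$ of five generalized patterns, $|S_n(P)|=n$ for every $n\ge1$: $\{1\text{ - }23,2\text{ - }13,31\text{ - }2,21\text{ - }3,3\text{ - }12\}$, $\{1\text{ - }23,2\text{ - }13,2\text{ - }31,21\text{ - }3,23\text{ - }1\}$, $\{12\text{ - }3,31\text{ - }2,2\text{ - }13,21\text{ - }3,3\text{ - }12\}$, $\{1\text{ - }23,2\text{ - }31,31\text{ - }2,23\text{ - }1,3\text{ - }12\}$, $\{2\text{ - }13,2\text{ - }31,1\text{ - }32,23\text{ - }1,21\text{ - }3\}$, $\{2\text{ - }13,2\text{ - }31,13\text{ - }2,23\text{ - }1,21\text{ - }3\}$, $\{2\text{ - }13,2\text{ - }31,13\text{ - }2,21\text{ - }3,1\text{ - }32\}$, $\{2\text{ - }13,23\text{ - }1,13\text{ - }2,1\text{ - }32,21\text{ - }3\}$, $\{2\text{ - }13,2\text{ - }31,13\text{ - }2,1\text{ - }32,23\text{ - }1\}$, $\{2\text{ - }31,21\text{ - }3,13\text{ - }2,23\text{ - }1,1\text{ - }32\}$, $\{1\text{ - }23,2\text{ - }13,2\text{ - }31,21\text{ - }3,12\text{ - }3\}$, $\{1\text{ - }23,2\text{ - }13,23\text{ - }1,21\text{ - }3,12\text{ - }3\}$, $\{1\text{ - }23,2\text{ - }13,3\text{ - }12,21\text{ - }3,12\text{ - }3\}$, $\{1\text{ - }23,2\text{ - }13,31\text{ - }2,21\text{ - }3,12\text{ - }3\}$, $\{1\text{ - }23,2\text{ - }13,2\text{ - }31,23\text{ - }1,12\text{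 - }3\}$, $\{1\text{ - }23,2\text{ - }13,31\text{ - }2,3\text{ - }12,12\text{ - }3\}$, $\{1\text{ - }23,21\text{ - }3,2\text{ - }31,23\text{ - }1,12\text{ - }3\}$, $\{1\text{ - }23,21\text{ - }3,31\text{ - }2,3\text{ - }12,12\text{ - }3\}$, $\{1\text{ - }23,2\text{ - }31,3\text{ - }12,23\text{ - }1,12\text{ - }3\}$, $\{1\text{ - }23,2\text{ - }31,31\text{ - }2,23\text{ - }1,12\text{ - }3\}$.
   Context: $S_n$ is the set of permutations $\pi=\pi_1\pi_2\cdots\pi_n$ of $\{1,\dots,n\}$. For $abc$ a permutation of $123$, the generalized pattern $a\text{ - }bc$ is contained in $\pi$ if there are indices $i<j$ with $j+1\le n$ such that $\pi_i\pi_j\pi_{j+1}$ is order-isomorphic to $abc$; the generalized pattern $ab\text{ - }c$ is contained in $\pi$ if there are indices $i,k$ with $i+1<k\le n$ such that $\pi_i\pi_{i+1}\pi_k$ is order-isomorphic to $abc$. (Letters not separated by a dash must occur in adjacent positions; letters separated by a dash need not be adjacent.) $\pi$ avoids a pattern if it does not contain it. For a set $P$ of generalized patterns, $S_n(P)$ is the set of $\pi\in S_n$ avoiding every pattern in $P$. -}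

module Defs where

open import Data.Fin.Base as Fin using (Fin; toℕ)
open import Data.Fin.Permutation using (Permutation′; _⟨$⟩ʳ_; _≈_)
open import Data.List.Base using (List; []; _∷_)
open import Data.List.Relation.Unary.All using (All)
open import Data.Nat.Base using (ℕ; suc; _<_)
open import Data.Product.Base using (Σ; _×_; ∃-syntax; proj₁)
open import Data.Vec.Base as Vec using (Vec; []; _∷_; lookup)
open import Function.Bundles using (Inverse; _⇔_)
open import Level using (0ℓ)
open import Relation.Binary.Bundles using (Setoid)
open import Relation.Binary.PropositionalEquality using (_≡_; refl; sym; trans; setoid)
open import Relation.Nullary.Negation using (¬_)

OrderIsomorphic : ∀ {m} → Vec ℕ m → Vec ℕ m → Set
OrderIsomorphic u v = ∀ x y → lookup u x < lookup u y ⇔ lookup v x < lookup v y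

-- a-bc  is  dash₁ (a ∷ b ∷ c ∷ [])  and  ab-c  is  dash₂ (a ∷ b ∷ c ∷ []).
data GenPattern : Set where
  dash₁ : Vec ℕ 3 → GenPattern
  dash₂ : Vec ℕ 3 → GenPattern

1-23 1-32 2-13 2-31 3-12 12-3 13-2 21-3 23-1 31-2 : GenPattern
1-23 = dash₁ (1 ∷ 2 ∷ 3 ∷ [])
1-32 = dash₁ (1 ∷ 3 ∷ 2 ∷ [])
2-13 = dash₁ (2 ∷ 1 ∷ 3 ∷ [])
2-31 = dash₁ (2 ∷ 3 ∷ 1 ∷ [])
3-12 = dash₁ (3 ∷ 1 ∷ 2 ∷ [])
12-3 = dash₂ (1 ∷ 2 ∷ 3 ∷ [])
13-2 = dash₂ (1 ∷ 3 ∷ 2 ∷ [])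
21-3 = dash₂ (2 ∷ 1 ∷ 3 ∷ [])
23-1 = dash₂ (2 ∷ 3 ∷ 1 ∷ [])
31-2 = dash₂ (3 ∷ 1 ∷ 2 ∷ [])

-- Positions and values are numbered from 0, so that π is a permutation of Fin n;
-- only the relative order of the values matters.
module _ {n : ℕ} (π : Permutation′ n) where

  subword : Fin n → Fin n → Fin n → Vec ℕ 3
  subword i j k = Vec.map (λ p → toℕ (π ⟨$⟩ʳ p)) (i ∷ j ∷ k ∷ [])

  Adjacent : Fin n → Fin n → Set
  Adjacent i j = toℕ j ≡ suc (toℕ i)

  Contains : GenPattern → Set
  Contains (dash₁ abc) =
    ∃[ i ] ∃[ j ] ∃[ k ] i Fin.< j × Adjacent j k × OrderIsomorphic (subword i j k) abc
  Contains (dash₂ abc) =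
    ∃[ i ] ∃[ j ] ∃[ k ] Adjacent i j × j Fin.< k × OrderIsomorphic (subword i j k) abc

  Avoids : GenPattern → Set
  Avoids p = ¬ Contains p

-- Two elements are equal when the underlying permutations agree pointwise; the
-- proofs of avoidance and the proofs of bijectivity are irrelevant.
S : ℕ → List GenPattern → Setoid 0ℓ 0ℓ
S n P = record
  { Carrier       = Σ (Permutation′ n) λ π → All (Avoids π) P
  ; _≈_           = λ σ τ → proj₁ σ ≈ proj₁ τ
  ; isEquivalence = record
    { refl  = λ _ → refl
    ; sym   = λ σ≈τ i → sym (σ≈τ i)
    ; trans = λ σ≈τ τ≈υ i → trans (σ≈τ i) (τ≈υ i)
    }
  }

HasCardinality : Setoid 0ℓ 0ℓ → ℕ → Set
HasCardinality A n = Inverse A (setoid (Fin n))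

patternSets : List (List GenPattern)
patternSets =
  (1-23 ∷ 2-13 ∷ 31-2 ∷ 21-3 ∷ 3-12 ∷ []) ∷
  (1-23 ∷ 2-13 ∷ 2-31 ∷ 21-3 ∷ 23-1 ∷ []) ∷
  (12-3 ∷ 31-2 ∷ 2-13 ∷ 21-3 ∷ 3-12 ∷ []) ∷
  (1-23 ∷ 2-31 ∷ 31-2 ∷ 23-1 ∷ 3-12 ∷ []) ∷
  (2-13 ∷ 2-31 ∷ 1-32 ∷ 23-1 ∷ 21-3 ∷ []) ∷
  (2-13 ∷ 2-31 ∷ 13-2 ∷ 23-1 ∷ 21-3 ∷ []) ∷
  (2-13 ∷ 2-31 ∷ 13-2 ∷ 21-3 ∷ 1-32 ∷ []) ∷
  (2-13 ∷ 23-1 ∷ 13-2 ∷ 1-32 ∷ 21-3 ∷ []) ∷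
  (2-13 ∷ 2-31 ∷ 13-2 ∷ 1-32 ∷ 23-1 ∷ []) ∷
  (2-31 ∷ 21-3 ∷ 13-2 ∷ 23-1 ∷ 1-32 ∷ []) ∷
  (1-23 ∷ 2-13 ∷ 2-31 ∷ 21-3 ∷ 12-3 ∷ []) ∷
  (1-23 ∷ 2-13 ∷ 23-1 ∷ 21-3 ∷ 12-3 ∷ []) ∷
  (1-23 ∷ 2-13 ∷ 3-12 ∷ 21-3 ∷ 12-3 ∷ []) ∷
  (1-23 ∷ 2-13 ∷ 31-2 ∷ 21-3 ∷ 12-3 ∷ []) ∷
  (1-23 ∷ 2-13 ∷ 2-31 ∷ 23-1 ∷ 12-3 ∷ []) ∷
  (1-23 ∷ 2-13 ∷ 31-2 ∷ 3-12 ∷ 12-3 ∷ []) ∷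
  (1-23 ∷ 21-3 ∷ 2-31 ∷ 23-1 ∷ 12-3 ∷ []) ∷
  (1-23 ∷ 21-3 ∷ 31-2 ∷ 3-12 ∷ 12-3 ∷ []) ∷
  (1-23 ∷ 2-31 ∷ 3-12 ∷ 23-1 ∷ 12-3 ∷ []) ∷
  (1-23 ∷ 2-31 ∷ 31-2 ∷ 23-1 ∷ 12-3 ∷ []) ∷ []

{-# OPTIONS --safe #-}

-- Each of the twenty sets consists of five of the six patterns a-bc, ab-c whose
-- underlying words range over three elements of S₃.  Writing R i j (for i < j)
-- for "πᵢ < πⱼ", an avoider satisfies one of four descriptions, where c is a
-- parameter with n possible values:
--   {123, 213, 312}:  R i j ⇔ i = 0 and j ≤ c   (c is the last j with πⱼ > π₀, or 0)
--   {123, 213, 231}:  R i j ⇔ i = c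
--   {123, 231, 312}:  R i j ⇔ i ≤ c < j
--   {132, 213, 231}:  R i j ⇔ c ≤ i
-- In the last three c is the first ascent, or the last position if there is none.
-- Each such relation R comes from exactly one permutation: its linear order of the
-- positions determines the values as ranks.
module Submission where

open import Defs
open import Data.Fin.Base as Fin using (Fin; suc; toℕ; fromℕ<; inject₁; punchOut)
open import Data.Fin.Induction using (<-weakInduction)
open import Data.Fin.Patterns using (0F; 1F; 2F)
import Data.Fin.Properties as Fin
open import Data.Fin.Permutation
  using (Permutation′; permutation; _⟨$⟩ʳ_; _⟨$⟩ˡ_; inverseˡ; inverseʳ; _≈_)
open import Data.Fin.Subset as Subset using (Subset; ∣_∣)
open import Data.Fin.Subset.Properties using (p⊂q⇒∣p∣<∣q∣; ∣⊤∣≡n; ⊆⊤; ∈⊤)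
open import Data.List.Base using (List; []; _∷_)
open import Data.List.Membership.Propositional using (_∈_)
import Data.List.Membership.DecPropositional as DecMembership
open import Data.List.Relation.Unary.All as All using (All; []; _∷_)
open import Data.List.Relation.Unary.Any as Any using (Any; here; there)
open import Data.Nat.Base using (ℕ; zero; suc; _+_; _≤_; _<_; _≥_; z≤n; s≤s)
open import Data.Nat.DivMod using (_mod_; m≤n⇒m%n≡m)
open import Data.Nat.Properties
open import Data.Product.Base using (_×_; _,_; proj₁; proj₂; ∃-syntax)
open import Data.Sum.Base using (_⊎_; inj₁; inj₂)
open import Data.Vec.Base using (Vec; []; _∷_; lookup; tabulate)
open import Data.Vec.Properties using (≡-dec; lookup∘tabulate; []=⇒lookup; lookup⇒[]=)
open import Function.Base using (_∘_; const)
open import Function.Bundles using (_⇔_; mk⇔; module Equivalence)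
open import Function.Definitions using (Injective)
open import Relation.Binary.Core using (Rel)
open import Relation.Binary.Definitions
  using (Transitive; Decidable; DecidableEquality; tri<; tri≈; tri>)
open import Relation.Binary.PropositionalEquality
  using (_≡_; _≢_; refl; sym; trans; cong; subst; subst₂)
open import Relation.Nullary using (¬_; Dec; yes; no; does; contradiction)
open import Relation.Nullary.Decidable
  using (True; False; toWitness; toWitnessFalse; map′; from-yes; _×-dec_; _⊎-dec_; ¬?;
         dec-true)
open import Level using (0ℓ)

open Equivalence using (to; from)

-- Equivalences of decided propositions, and bounded search

both : ∀ {P Q : Set} → P → Q → P ⇔ Q
both p q = mk⇔ (const q) (const p)

neither : ∀ {P Q : Set} → ¬ P → ¬ Q → P ⇔ Q
neither ¬p ¬q = mk⇔ (λ p → contradiction p ¬p) (λ q → contradiction q ¬q)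

-- The default `c = N` means that no index below `N` satisfies `Q`; hence `Q c` is promised only
-- when `c < N`.
leastUpTo : {Q : ℕ → Set} → (∀ i → Dec (Q i)) → ∀ N →
            ∃[ c ] c ≤ N × (∀ {i} → i < c → ¬ Q i) × (c < N → Q c)
leastUpTo Q? zero = 0 , z≤n , (λ ()) , (λ ())
leastUpTo Q? (suc N) with leastUpTo Q? N
... | c , c≤N , before , at with m≤n⇒m<n∨m≡n c≤N
...   | inj₁ c<N = c , m≤n⇒m≤1+n c≤N , before , (λ _ → at c<N)
...   | inj₂ refl with Q? c
...     | yes q = c , m≤n⇒m≤1+n c≤N , before , (λ _ → q)
...     | no ¬q = suc c , ≤-refl , before′ , (λ c<c → contradiction c<c (<-irrefl refl))
  where
  before′ : ∀ {i} → i < suc c → ¬ _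
  before′ i<1+c with m<1+n⇒m<n∨m≡n i<1+c
  ... | inj₁ i<c  = before i<c
  ... | inj₂ refl = ¬q

-- Permutations of Fin n

-- Pigeonhole: punching a missed value `y` out of the codomain would inject `Fin (suc n)` into
-- `Fin n`.
injective⇒surjective : ∀ {n} {f : Fin n → Fin n} → Injective _≡_ _≡_ f → ∀ y → ∃[ x ] f x ≡ y
injective⇒surjective {suc n} {f} inj y with Fin.any? (λ x → f x Fin.≟ y)
... | yes hit = hit
... | no miss = contradiction (Fin.injective⇒≤ avoid-injective) 1+n≰n
  where
  y≢f : ∀ x → y ≢ f x
  y≢f x y≡fx = miss (x , sym y≡fx)
  avoid-injective : Injective _≡_ _≡_ (λ x → punchOut (y≢f x))
  avoid-injective = inj ∘ Fin.punchOut-injective (y≢f _) (y≢f _)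

injective⇒permutation : ∀ {n} (f : Fin n → Fin n) → Injective _≡_ _≡_ f → Permutation′ n
injective⇒permutation f inj =
  permutation f (proj₁ ∘ surj) (proj₂ ∘ surj) (λ x → inj (proj₂ (surj (f x))))
  where surj = injective⇒surjective inj

strictlyMonotone⇒inflationary : ∀ {n} (f : Fin n → Fin n) →
  (∀ {i j} → i Fin.< j → f i Fin.< f j) → ∀ i → i Fin.≤ f i
strictlyMonotone⇒inflationary {suc n} f mono = <-weakInduction (λ i → i Fin.≤ f i) z≤n step
  where
  step : ∀ i → inject₁ i Fin.≤ f (inject₁ i) → suc i Fin.≤ f (suc i)
  step i ih = ≤-<-trans (subst (_≤ toℕ (f (inject₁ i))) (Fin.toℕ-inject₁ i) ih)
                        (mono (s≤s (≤-reflexive (Fin.toℕ-inject₁ i))))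

-- `σ` after the inverse of `π` is strictly monotone, hence inflationary; evaluate it at the value
-- of `π` at `i`.
sameOrder⇒≤ : ∀ {n} (π σ : Permutation′ n) →
  (∀ {i j} → π ⟨$⟩ʳ i Fin.< π ⟨$⟩ʳ j → σ ⟨$⟩ʳ i Fin.< σ ⟨$⟩ʳ j) → ∀ i → π ⟨$⟩ʳ i Fin.≤ σ ⟨$⟩ʳ i
sameOrder⇒≤ π σ mono i =
  subst (λ j → π ⟨$⟩ʳ i Fin.≤ σ ⟨$⟩ʳ j) (inverseˡ π)
    (strictlyMonotone⇒inflationary (λ x → σ ⟨$⟩ʳ (π ⟨$⟩ˡ x))
      (mono ∘ subst₂ Fin._<_ (sym (inverseʳ π)) (sym (inverseʳ π))) (π ⟨$⟩ʳ i))

-- Permutations realizing a prescribed set of non-inversions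

Realizes : ∀ {n} → (ℕ → ℕ → Set) → Permutation′ n → Set
Realizes R π = ∀ {i j} → i Fin.< j → (π ⟨$⟩ʳ i Fin.< π ⟨$⟩ʳ j) ⇔ R (toℕ i) (toℕ j)

⟨$⟩ʳ-injective : ∀ {n} (π : Permutation′ n) {i j} → π ⟨$⟩ʳ i ≡ π ⟨$⟩ʳ j → i ≡ j
⟨$⟩ʳ-injective π eq = trans (sym (inverseˡ π)) (trans (cong (π ⟨$⟩ˡ_) eq) (inverseˡ π))

realizes⇒sameOrder : ∀ {n} R (π σ : Permutation′ n) → Realizes R π → Realizes R σ →
  ∀ {i j} → π ⟨$⟩ʳ i Fin.< π ⟨$⟩ʳ j → σ ⟨$⟩ʳ i Fin.< σ ⟨$⟩ʳ j
realizes⇒sameOrder R π σ πR σR {i} {j} πi<πj with Fin.<-cmp i j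
... | tri< i<j _ _ = from (σR i<j) (to (πR i<j) πi<πj)
... | tri≈ _ refl _ = contradiction πi<πj (<-irrefl refl)
... | tri> _ i≢j j<i with Fin.<-cmp (σ ⟨$⟩ʳ i) (σ ⟨$⟩ʳ j)
...   | tri< σi<σj _ _ = σi<σj
...   | tri≈ _ σi≡σj _ = contradiction (⟨$⟩ʳ-injective σ σi≡σj) i≢j
...   | tri> _ _ σj<σi = contradiction (from (πR j<i) (to (σR j<i) σj<σi)) (<-asym πi<πj)

realizes-unique : ∀ {n} R (π σ : Permutation′ n) → Realizes R π → Realizes R σ → π ≈ σ
realizes-unique R π σ πR σR i =
  Fin.≤-antisym (sameOrder⇒≤ π σ (realizes⇒sameOrder R π σ πR σR) i)
                (sameOrder⇒≤ σ π (realizes⇒sameOrder R σ π σR πR) i)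

TransitiveBelow : (ℕ → ℕ → Set) → Set
TransitiveBelow R = ∀ {i j k} → i < j → j < k → R i j → R j k → R i k

-- Transitivity of a set of pairs and of its complement is the classical characterization of
-- (non-)inversion sets: together they make `_≺_` a strict total order of the positions.
module Realization {R : ℕ → ℕ → Set} (R? : Decidable R)
                   (R-trans : TransitiveBelow R)
                   (R-cotrans : TransitiveBelow (λ i j → ¬ R i j)) where

  _≺_ : ℕ → ℕ → Set
  i ≺ j = (i < j × R i j) ⊎ (j < i × ¬ R j i)

  _≺?_ : Decidable _≺_
  i ≺? j = (i <? j ×-dec R? i j) ⊎-dec (j <? i ×-dec ¬? (R? j i))

  ≺-irrefl : ∀ {i} → ¬ (i ≺ i)
  ≺-irrefl (inj₁ (i<i , _)) = <-irrefl refl i<i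
  ≺-irrefl (inj₂ (i<i , _)) = <-irrefl refl i<i

  ≺-total : ∀ {i j} → i ≢ j → i ≺ j ⊎ j ≺ i
  ≺-total {i} {j} i≢j with <-cmp i j
  ... | tri≈ _ i≡j _ = contradiction i≡j i≢j
  ... | tri< i<j _ _ with R? i j
  ...   | yes r = inj₁ (inj₁ (i<j , r))
  ...   | no ¬r = inj₂ (inj₂ (i<j , ¬r))
  ≺-total {i} {j} i≢j | tri> _ _ j<i with R? j i
  ...   | yes r = inj₂ (inj₁ (j<i , r))
  ...   | no ¬r = inj₁ (inj₂ (j<i , ¬r))

  -- In the mixed cases `i` and `k` are compared as positions; the wrong outcome would violate
  -- transitivity of `R` or of its complement on the sorted triple.
  ≺-trans : Transitive _≺_
  ≺-trans (inj₁ (i<j , Rij)) (inj₁ (j<k , Rjk)) =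
    inj₁ (<-trans i<j j<k , R-trans i<j j<k Rij Rjk)
  ≺-trans (inj₂ (j<i , ¬Rji)) (inj₂ (k<j , ¬Rkj)) =
    inj₂ (<-trans k<j j<i , R-cotrans k<j j<i ¬Rkj ¬Rji)
  ≺-trans {i} {_} {k} (inj₁ (i<j , Rij)) (inj₂ (k<j , ¬Rkj)) with <-cmp i k
  ... | tri≈ _ refl _ = contradiction Rij ¬Rkj
  ... | tri> _ _ k<i = inj₂ (k<i , λ Rki → ¬Rkj (R-trans k<i i<j Rki Rij))
  ... | tri< i<k _ _ with R? i k
  ...   | yes Rik = inj₁ (i<k , Rik)
  ...   | no ¬Rik = contradiction Rij (R-cotrans i<k k<j ¬Rik ¬Rkj)
  ≺-trans {i} {_} {k} (inj₂ (j<i , ¬Rji)) (inj₁ (j<k , Rjk)) with <-cmp i k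
  ... | tri≈ _ refl _ = contradiction Rjk ¬Rji
  ... | tri> _ _ k<i = inj₂ (k<i , λ Rki → ¬Rji (R-trans j<k k<i Rjk Rki))
  ... | tri< i<k _ _ with R? i k
  ...   | yes Rik = inj₁ (i<k , Rik)
  ...   | no ¬Rik = contradiction Rjk (R-cotrans j<i i<k ¬Rji ¬Rik)

  module _ {n : ℕ} where

    -- The number of these predecessors will be the value at `i`.
    below : Fin n → Subset n
    below i = tabulate (λ k → does (toℕ k ≺? toℕ i))

    ∈-below⁺ : ∀ {i k} → toℕ k ≺ toℕ i → k Subset.∈ below i
    ∈-below⁺ {i} {k} k≺i =
      lookup⇒[]= k _ (trans (lookup∘tabulate _ k) (dec-true (toℕ k ≺? toℕ i) k≺i))

    ∈-below⁻ : ∀ {i k} → k Subset.∈ below i → toℕ k ≺ toℕ i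
    ∈-below⁻ {i} {k} k∈ with toℕ k ≺? toℕ i in eq
    ... | yes k≺i = k≺i
    ... | no ¬k≺i = contradiction
      (trans (sym ([]=⇒lookup k∈)) (trans (lookup∘tabulate _ k) (cong does eq))) (λ ())

    rank< : ∀ i → ∣ below i ∣ < n
    rank< i = subst (∣ below i ∣ <_) (∣⊤∣≡n n)
                -- The inclusion in the full set is proper because `i` does not precede itself.
                (p⊂q⇒∣p∣<∣q∣ (⊆⊤ , i , ∈⊤ , ≺-irrefl ∘ ∈-below⁻))

    rank : Fin n → Fin n
    rank i = fromℕ< (rank< i)

    rank-mono : ∀ {i j} → toℕ i ≺ toℕ j → rank i Fin.< rank j
    rank-mono {i} {j} i≺j =
      subst₂ _<_ (sym (Fin.toℕ-fromℕ< (rank< i))) (sym (Fin.toℕ-fromℕ< (rank< j)))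
        (p⊂q⇒∣p∣<∣q∣ ((λ k∈ → ∈-below⁺ (≺-trans (∈-below⁻ k∈) i≺j)) ,
                       i , ∈-below⁺ i≺j , ≺-irrefl ∘ ∈-below⁻))

    rank-injective : Injective _≡_ _≡_ rank
    rank-injective {i} {j} eq with i Fin.≟ j
    ... | yes i≡j = i≡j
    ... | no i≢j with ≺-total (i≢j ∘ Fin.toℕ-injective)
    ...   | inj₁ i≺j = contradiction (rank-mono i≺j) (<-irrefl (cong toℕ eq))
    ...   | inj₂ j≺i = contradiction (rank-mono j≺i) (<-irrefl (cong toℕ (sym eq)))

    realization : Permutation′ n
    realization = injective⇒permutation rank rank-injective

    realization-realizes : Realizes R realization
    realization-realizes {i} {j} i<j with R? (toℕ i) (toℕ j)
    ... | yes r = both (rank-mono (inj₁ (i<j , r))) r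
    ... | no ¬r = neither (<-asym (rank-mono (inj₂ (i<j , ¬r)))) ¬r

-- Order isomorphism of words of length three

-- The comparison of the pattern letters `a`, `b` is implicit: on literals it is settled by
-- evaluation, so only the comparison of `x` and `y` has to be supplied.
data SameOrder (x y a b : ℕ) : Set where
  up   : x < y → {True (a <? b)} → SameOrder x y a b
  down : y < x → {True (b <? a)} → SameOrder x y a b

sameOrder⇒⇔ : ∀ {x y a b} → SameOrder x y a b → x < y ⇔ a < b
sameOrder⇒⇔ (up x<y {a<b})   = both x<y (toWitness a<b)
sameOrder⇒⇔ (down y<x {b<a}) = neither (<-asym y<x) (<-asym (toWitness b<a))

sameOrder-sym : ∀ {x y a b} → SameOrder x y a b → SameOrder y x b a
sameOrder-sym (up x<y {a<b})   = down x<y {a<b}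
sameOrder-sym (down y<x {b<a}) = up y<x {b<a}

isomorphic : ∀ {x y z a b c} → SameOrder x y a b → SameOrder y z b c → SameOrder x z a c →
             OrderIsomorphic (x ∷ y ∷ z ∷ []) (a ∷ b ∷ c ∷ [])
isomorphic xy yz xz 0F 0F = neither (<-irrefl refl) (<-irrefl refl)
isomorphic xy yz xz 0F 1F = sameOrder⇒⇔ xy
isomorphic xy yz xz 0F 2F = sameOrder⇒⇔ xz
isomorphic xy yz xz 1F 0F = sameOrder⇒⇔ (sameOrder-sym xy)
isomorphic xy yz xz 1F 1F = neither (<-irrefl refl) (<-irrefl refl)
isomorphic xy yz xz 1F 2F = sameOrder⇒⇔ yz
isomorphic xy yz xz 2F 0F = sameOrder⇒⇔ (sameOrder-sym xz)
isomorphic xy yz xz 2F 1F = sameOrder⇒⇔ (sameOrder-sym yz)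
isomorphic xy yz xz 2F 2F = neither (<-irrefl refl) (<-irrefl refl)

-- Avoidance for words w 0, …, w N

underlying : GenPattern → Vec ℕ 3
underlying (dash₁ abc) = abc
underlying (dash₂ abc) = abc

-- Positions are natural numbers with a bound, so that neighbours can be written with `suc` and
-- inductions on positions need no coercions.
WordAvoids : ℕ → (ℕ → ℕ) → GenPattern → Set
WordAvoids N w (dash₁ abc) =
  ∀ {i j} → i < j → suc j ≤ N → ¬ OrderIsomorphic (w i ∷ w j ∷ w (suc j) ∷ []) abc
WordAvoids N w (dash₂ abc) =
  ∀ {i k} → suc i < k → k ≤ N → ¬ OrderIsomorphic (w i ∷ w (suc i) ∷ w k ∷ []) abc

WordDistinct : ℕ → (ℕ → ℕ) → Set
WordDistinct N w = ∀ {i j} → i < j → j ≤ N → w i ≢ w j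

WordRealizes : ℕ → (ℕ → ℕ → Set) → (ℕ → ℕ) → Set
WordRealizes N R w = ∀ {i j} → i < j → j ≤ N → w i < w j ⇔ R i j

-- Three consecutive letters are an occurrence of both dashed forms of a word, so avoiding either
-- form excludes them.
avoidsConsecutive : ∀ {N w abc} → Any (WordAvoids N w) (dash₁ abc ∷ dash₂ abc ∷ []) →
  ∀ {i} → 2 + i ≤ N → ¬ OrderIsomorphic (w i ∷ w (1 + i) ∷ w (2 + i) ∷ []) abc
avoidsConsecutive (here avoids)         = avoids ≤-refl
avoidsConsecutive (there (here avoids)) = avoids ≤-refl

chain : ∀ (_~_ : Rel ℕ 0ℓ) → Transitive _~_ → ∀ (w : ℕ → ℕ) {a b} →
        (∀ {i} → a ≤ i → suc i ≤ b → w i ~ w (suc i)) →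
        ∀ {i j} → a ≤ i → i < j → j ≤ b → w i ~ w j
chain _~_ ~-trans w step {i} {suc j} a≤i i<1+j 1+j≤b with m<1+n⇒m<n∨m≡n i<1+j
... | inj₂ refl = step a≤i 1+j≤b
... | inj₁ i<j  = ~-trans (chain _~_ ~-trans w step a≤i i<j (<⇒≤ 1+j≤b))
                          (step (≤-trans a≤i (<⇒≤ i<j)) 1+j≤b)

descending : ∀ (w : ℕ → ℕ) {a b} → (∀ {i} → a ≤ i → suc i ≤ b → w (suc i) < w i) →
             ∀ {i j} → a ≤ i → i < j → j ≤ b → w j < w i
descending = chain (λ x y → y < x) (λ y<x z<y → <-trans z<y y<x)

-- Shape R i j k abc says that a word realizing R has the pattern abc at i < j < k.
Shape : (ℕ → ℕ → Set) → ℕ → ℕ → ℕ → Vec ℕ 3 → Set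
Shape R i j k abc = (R i j ⇔ lookup abc 0F < lookup abc 1F)
                  × (R j k ⇔ lookup abc 1F < lookup abc 2F)
                  × (R i k ⇔ lookup abc 0F < lookup abc 2F)

Excludes : (ℕ → ℕ → Set) → Vec ℕ 3 → Set
Excludes R abc = ∀ {i j k} → i < j → j < k → ¬ Shape R i j k abc

-- `words` are the words excluded at all increasing triples, adjacent or not. `clauses` is a
-- conjunction of disjunctions of patterns whose avoidance already forces some `R c`. In `separates`
-- the bound `j ≤ d` keeps the distinguishing pair inside every word with `d ≤ N`.
record Family : Set₁ where
  field
    R         : ℕ → ℕ → ℕ → Set
    R?        : ∀ c → Decidable (R c)
    R-trans   : ∀ {c} → TransitiveBelow (R c)
    R-cotrans : ∀ {c} → TransitiveBelow (λ i j → ¬ R c i j)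
    separates : ∀ {c d} → c < d → ∃[ i ] ∃[ j ] i < j × j ≤ d × ¬ (R c i j ⇔ R d i j)
    words     : List (Vec ℕ 3)
    excludes  : ∀ {c} → All (Excludes (R c)) words
    clauses   : List (List GenPattern)
    classify  : ∀ {N w} → WordDistinct N w → All (Any (WordAvoids N w)) clauses →
                ∃[ c ] c ≤ N × WordRealizes N (R c) w

ascending : ∀ {P : Set} {a b} → P ⇔ a < b → {True (a <? b)} → P
ascending e {a<b} = from e (toWitness a<b)

notAscending : ∀ {P : Set} {a b} → P ⇔ a < b → {False (a <? b)} → ¬ P
notAscending e {a≮b} p = toWitnessFalse a≮b (to e p)

-- Comparing letters, and the first ascent of a word

module WordOrder {N : ℕ} {w : ℕ → ℕ} (distinct : WordDistinct N w) where

  compare : ∀ {i j} → i < j → j ≤ N → w i < w j ⊎ w j < w i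
  compare {i} {j} i<j j≤N with <-cmp (w i) (w j)
  ... | tri< wi<wj _ _ = inj₁ wi<wj
  ... | tri≈ _ wi≡wj _ = contradiction wi≡wj (distinct i<j j≤N)
  ... | tri> _ _ wj<wi = inj₂ wj<wi

  ≮⇒> : ∀ {i j} → i < j → j ≤ N → ¬ (w i < w j) → w j < w i
  ≮⇒> i<j j≤N wi≮wj with compare i<j j≤N
  ... | inj₁ wi<wj = contradiction wi<wj wi≮wj
  ... | inj₂ wj<wi = wj<wi

  ≯⇒< : ∀ {i j} → i < j → j ≤ N → ¬ (w j < w i) → w i < w j
  ≯⇒< i<j j≤N wj≮wi with compare i<j j≤N
  ... | inj₁ wi<wj = wi<wj
  ... | inj₂ wj<wi = contradiction wj<wi wj≮wi

module FirstAscent {N : ℕ} {w : ℕ → ℕ} (distinct : WordDistinct N w) where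

  open WordOrder distinct

  private least = leastUpTo (λ i → w i <? w (suc i)) N

  c : ℕ
  c = proj₁ least

  c≤N : c ≤ N
  c≤N = proj₁ (proj₂ least)

  ascent : c < N → w c < w (suc c)
  ascent = proj₂ (proj₂ (proj₂ least))

  descent : ∀ {i} → i < c → w (suc i) < w i
  descent i<c = ≮⇒> ≤-refl (≤-trans i<c c≤N) (proj₁ (proj₂ (proj₂ least)) i<c)

  before : ∀ {i j} → i < j → j ≤ c → w j < w i
  before = descending w (λ _ → descent) z≤n

-- k, n, n - 1, …, 1 (with k omitted from the descending part)
largeFirst : Family
largeFirst = record
  { R         = R
  ; R?        = λ c i j → i ≟ 0 ×-dec j ≤? c
  ; R-trans   = λ { () _ (_ , _) (refl , _) }
  ; R-cotrans = λ { _ j<k ¬Rij _ (i≡0 , k≤c) → ¬Rij (i≡0 , ≤-trans (<⇒≤ j<k) k≤c) }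
  -- The pair `(0 , d)` is related for parameter `d` but not for `c`.
  ; separates = λ { {d = d} c<d → 0 , d , ≤-<-trans z≤n c<d , ≤-refl ,
                    λ e → <⇒≱ c<d (proj₂ (from e (refl , ≤-refl))) }
  ; words     = underlying 1-23 ∷ underlying 2-13 ∷ underlying 3-12 ∷ []
  -- All three words end in an ascent, which here could only start at position 0, yet `i < j`.
  ; excludes  = (λ i<j _ (_ , jk , _) → absurd i<j (ascending jk))
              ∷ (λ i<j _ (_ , jk , _) → absurd i<j (ascending jk))
              ∷ (λ i<j _ (_ , jk , _) → absurd i<j (ascending jk)) ∷ []
  ; clauses   = (1-23 ∷ 12-3 ∷ []) ∷ (2-13 ∷ 21-3 ∷ []) ∷ (3-12 ∷ 31-2 ∷ []) ∷ []
  ; classify  = classify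
  }
  where
  R : ℕ → ℕ → ℕ → Set
  R c i j = i ≡ 0 × j ≤ c

  absurd : ∀ {c i j k} → i < j → ¬ R c j k
  absurd () (refl , _)

  classify : ∀ {N w} → WordDistinct N w → All (Any (WordAvoids N w)) _ →
             ∃[ c ] c ≤ N × WordRealizes N (R c) w
  classify {N} {w} distinct (a123 ∷ a213 ∷ a312 ∷ [])
    -- The index is shifted: positions 1 to `c` lie above `w 0`, and position `suc c`, if present,
    -- is the first one below it.
    with leastUpTo (λ i → w (suc i) <? w 0) N
  ... | c , c≤N , above , below = c , c≤N , realizes
    where
    open WordOrder distinct

    -- An ascent starting after position 0 has a letter before it, and the three letters form 123,
    -- 213 or 312.
    descent : ∀ {i} → 1 ≤ i → suc i ≤ N → w (suc i) < w i
    descent {suc i} _ 2+i≤N = ≮⇒> ≤-refl 2+i≤N noAscent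
      where
      noAscent : ¬ (w (suc i) < w (2 + i))
      noAscent p with compare {i} {suc i} ≤-refl (<⇒≤ 2+i≤N)
                    | compare {i} {2 + i} (m<n⇒m<1+n ≤-refl) 2+i≤N
      ... | inj₁ q | _ =
        avoidsConsecutive a123 2+i≤N (isomorphic (up q) (up p) (up (<-trans q p)))
      ... | inj₂ q | inj₁ r = avoidsConsecutive a213 2+i≤N (isomorphic (down q) (up p) (up r))
      ... | inj₂ q | inj₂ r = avoidsConsecutive a312 2+i≤N (isomorphic (down q) (up p) (down r))

    realizes : WordRealizes N (R c) w
    realizes {suc i} i<j j≤N =
      neither (<-asym (descending w descent (s≤s z≤n) i<j j≤N)) (λ { (() , _) })
    realizes {zero} {suc j} 0<j 1+j≤N with j <? c
    ... | yes j<c = both (≯⇒< 0<j 1+j≤N (above j<c)) (refl , j<c)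
    ... | no j≮c = neither (<-asym (lower (m≤n⇒m<n∨m≡n (≮⇒≥ j≮c)))) (j≮c ∘ proj₂)
      where
      lower : c < j ⊎ c ≡ j → w (suc j) < w 0
      lower (inj₂ refl) = below 1+j≤N
      lower (inj₁ c<j)  =
        <-trans (descending w descent (s≤s z≤n) (s≤s c<j) 1+j≤N)
                (below (≤-trans (m<n⇒m<1+n c<j) 1+j≤N))

-- n, n - 1, …, 2 with 1 inserted at position c
smallInserted : Family
smallInserted = record
  { R         = R
  ; R?        = λ c i j → i ≟ c
  ; R-trans   = λ { _ _ Rij _ → Rij }
  ; R-cotrans = λ { _ _ ¬Rij _ → ¬Rij }
  ; separates = λ { {c} {d} c<d → c , d , c<d , ≤-refl , λ e → <⇒≢ c<d (to e refl) }
  ; words     = underlying 1-23 ∷ underlying 2-13 ∷ underlying 2-31 ∷ []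
  ; excludes  = (λ i<j _ (ij , jk , _) → <⇒≢ i<j (trans (ascending ij) (sym (ascending jk))))
              ∷ (λ i<j _ (_ , jk , ik) → <⇒≢ i<j (trans (ascending ik) (sym (ascending jk))))
              ∷ (λ _ _ (ij , _ , ik) → notAscending ik (ascending ij)) ∷ []
  ; clauses   = (1-23 ∷ []) ∷ (2-13 ∷ 21-3 ∷ []) ∷ (2-31 ∷ 23-1 ∷ []) ∷ []
  ; classify  = classify
  }
  where
  R : ℕ → ℕ → ℕ → Set
  R c i j = i ≡ c

  classify : ∀ {N w} → WordDistinct N w → All (Any (WordAvoids N w)) _ →
             ∃[ c ] c ≤ N × WordRealizes N (R c) w
  classify {N} {w} distinct (here a123 ∷ a213 ∷ a231 ∷ []) = c , c≤N , realizes
    where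
    open WordOrder distinct
    open FirstAscent distinct

    -- Induction on `k`. If `w (suc k)` were the first to drop below `w c`, then `c, k, suc k` would
    -- form 2-31 and `c, suc c, suc k` would form 23-1.
    minimum : ∀ {k} → c < k → k ≤ N → w c < w k
    minimum {suc k} c<1+k 1+k≤N with m<1+n⇒m<n∨m≡n c<1+k
    ... | inj₂ refl = ascent 1+k≤N
    ... | inj₁ c<k  = ≯⇒< c<1+k 1+k≤N (no231 a231)
      where
      wc<wk : w c < w k
      wc<wk = minimum c<k (<⇒≤ 1+k≤N)
      wc<w[1+c] : w c < w (suc c)
      wc<w[1+c] = ascent (≤-trans c<1+k 1+k≤N)
      no231 : Any (WordAvoids N w) (2-31 ∷ 23-1 ∷ []) → ¬ (w (suc k) < w c)
      no231 (here avoids) p =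
        avoids c<k 1+k≤N (isomorphic (up wc<wk) (down (<-trans p wc<wk)) (down p))
      no231 (there (here avoids)) p =
        avoids (s≤s c<k) 1+k≤N (isomorphic (up wc<w[1+c]) (down (<-trans p wc<w[1+c])) (down p))

    -- An ascent beyond `c` would complete a 1-23 with the smaller letter `w c`.
    after : ∀ {k} → c < k → suc k ≤ N → w (suc k) < w k
    after c<k 1+k≤N = ≮⇒> ≤-refl 1+k≤N
      (λ p → let q = minimum c<k (<⇒≤ 1+k≤N) in
             a123 c<k 1+k≤N (isomorphic (up q) (up p) (up (<-trans q p))))

    -- Otherwise the three consecutive letters form 213. The equation `suc b ≡ d` allows `d` to be
    -- `c`, which is not syntactically a successor.
    valley : ∀ {b d} → suc b ≡ d → suc d ≤ N → w d < w b → w d < w (suc d) → w (suc d) < w b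
    valley refl 2+b≤N q r = ≮⇒> (m<n⇒m<1+n ≤-refl) 2+b≤N
      (λ p → avoidsConsecutive a213 2+b≤N (isomorphic (down q) (up r) (up p)))

    -- Recursion on the distance `d` from `suc i` to `c`: `valley` handles the letter just before
    -- `c`, and earlier letters are larger still.
    peak : c < N → ∀ d {i} → d + suc i ≡ c → w (suc c) < w i
    peak c<N zero    eq = valley eq c<N (before (≤-reflexive eq) ≤-refl) (ascent c<N)
    peak c<N (suc d) {i} eq =
      <-trans (peak c<N d (trans (+-suc d (suc i)) eq))
              (descent (subst (i <_) eq (≤-trans (m≤n+m (suc i) d) (n≤1+n _))))

    realizes : WordRealizes N (R c) w
    realizes {i} {j} i<j j≤N with <-cmp i c
    ... | tri≈ _ refl _ = both (minimum i<j j≤N) refl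
    ... | tri> _ i≢c c<i = neither (<-asym (descending w after c<i i<j j≤N)) i≢c
    ... | tri< i<c i≢c _ with j ≤? c
    ...   | yes j≤c = neither (<-asym (before i<j j≤c)) i≢c
    ...   | no j≰c  = neither (<-asym (lower (m≤n⇒m<n∨m≡n c<j))) i≢c
      where
      c<j : c < j
      c<j = ≰⇒> j≰c
      w[1+c]<wi : w (suc c) < w i
      w[1+c]<wi = peak (≤-trans c<j j≤N) _ (m∸n+n≡m i<c)
      lower : suc c < j ⊎ suc c ≡ j → w j < w i
      lower (inj₂ refl)  = w[1+c]<wi
      lower (inj₁ 1+c<j) = <-trans (descending w after ≤-refl 1+c<j j≤N) w[1+c]<wi

-- c + 1, …, 1, n, …, c + 2
twoDescents : Family
twoDescents = record
  { R         = R
  ; R?        = λ c i j → i ≤? c ×-dec c <? j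
  ; R-trans   = λ { _ _ (_ , c<j) (j≤c , _) → contradiction j≤c (<⇒≱ c<j) }
  ; R-cotrans = λ { i<j _ ¬Rij ¬Rjk (i≤c , c<k) →
                    ¬Rjk (≮⇒≥ (λ c<j → ¬Rij (i≤c , c<j)) , c<k) }
  ; separates = λ { {c} {d} c<d → c , d , c<d , ≤-refl ,
                    λ e → <-irrefl refl (proj₂ (to e (≤-refl , c<d))) }
  ; words     = underlying 1-23 ∷ underlying 2-31 ∷ underlying 3-12 ∷ []
  ; excludes  = (λ _ _ (ij , jk , _) → <⇒≱ (proj₂ (ascending ij)) (proj₁ (ascending jk)))
              ∷ (λ _ j<k (ij , _ , ik) → let (i≤c , c<j) = ascending ij in
                   notAscending ik (i≤c , <-trans c<j j<k))
              ∷ (λ i<j _ (_ , jk , ik) → let (j≤c , c<k) = ascending jk in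
                   notAscending ik (≤-trans (<⇒≤ i<j) j≤c , c<k)) ∷ []
  ; clauses   = (1-23 ∷ []) ∷ (2-31 ∷ []) ∷ (3-12 ∷ 31-2 ∷ []) ∷ []
  ; classify  = classify
  }
  where
  R : ℕ → ℕ → ℕ → Set
  R c i j = i ≤ c × c < j

  classify : ∀ {N w} → WordDistinct N w → All (Any (WordAvoids N w)) _ →
             ∃[ c ] c ≤ N × WordRealizes N (R c) w
  classify {N} {w} distinct (here a123 ∷ here a231 ∷ a312 ∷ []) = c , c≤N , realizes
    where
    open WordOrder distinct
    open FirstAscent distinct

    -- Recursion on the distance `d` from `i` to `c`. A letter `w i` above `w (suc c)` would give
    -- 3-12 at `i, c, suc c` and, by the claim for `suc i`, 31-2 at `i, suc i, suc c`.
    peak : c < N → ∀ d {i} → d + i ≡ c → w i < w (suc c)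
    peak c<N zero    refl = ascent c<N
    peak c<N (suc d) {i} eq = ≯⇒< (m<n⇒m<1+n i<c) c<N (no312 a312)
      where
      i<c : i < c
      i<c = subst (i <_) eq (s≤s (m≤n+m i d))
      no312 : Any (WordAvoids N w) (3-12 ∷ 31-2 ∷ []) → ¬ (w (suc c) < w i)
      no312 (here avoids) p =
        avoids i<c c<N (isomorphic (down (before i<c ≤-refl)) (up (ascent c<N)) (down p))
      no312 (there (here avoids)) p =
        avoids (s≤s i<c) c<N
          (isomorphic (down (descent i<c)) (up (peak c<N d (trans (+-suc d i) eq))) (down p))

    -- Induction on `k` from `peak`: a drop of `w (suc k)` below `w i` would give 2-31 at
    -- `i, k, suc k`.
    dominates : ∀ {i k} → i ≤ c → c < k → k ≤ N → w i < w k
    dominates {i} {suc k} i≤c c<1+k 1+k≤N with m<1+n⇒m<n∨m≡n c<1+k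
    ... | inj₂ refl = peak 1+k≤N _ (m∸n+n≡m i≤c)
    ... | inj₁ c<k  = ≯⇒< (≤-<-trans i≤c c<1+k) 1+k≤N
      (λ p → let q = dominates i≤c c<k (<⇒≤ 1+k≤N) in
             a231 (≤-<-trans i≤c c<k) 1+k≤N (isomorphic (up q) (down (<-trans p q)) (down p)))

    after : ∀ {k} → c < k → suc k ≤ N → w (suc k) < w k
    after c<k 1+k≤N = ≮⇒> ≤-refl 1+k≤N
      (λ p → let q = dominates ≤-refl c<k (<⇒≤ 1+k≤N) in
             a123 c<k 1+k≤N (isomorphic (up q) (up p) (up (<-trans q p))))

    realizes : WordRealizes N (R c) w
    realizes {i} {j} i<j j≤N with i ≤? c | c <? j
    ... | yes i≤c | yes c<j = both (dominates i≤c c<j j≤N) (i≤c , c<j)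
    ... | yes i≤c | no c≮j  = neither (<-asym (before i<j (≮⇒≥ c≮j))) (c≮j ∘ proj₂)
    ... | no i≰c  | _       =
      neither (<-asym (descending w after (≰⇒> i≰c) i<j j≤N)) (i≰c ∘ proj₁)

-- n, n - 1, …, n - c + 1, 1, 2, …, n - c
finalAscents : Family
finalAscents = record
  { R         = R
  ; R?        = λ c i j → c ≤? i
  ; R-trans   = λ { _ _ Rij _ → Rij }
  ; R-cotrans = λ { _ _ ¬Rij _ → ¬Rij }
  ; separates = λ { {c} {d} c<d → c , d , c<d , ≤-refl , λ e → <⇒≱ c<d (to e ≤-refl) }
  ; words     = underlying 1-32 ∷ underlying 2-13 ∷ underlying 2-31 ∷ []
  ; excludes  = (λ i<j _ (ij , jk , _) → notAscending jk (≤-trans (ascending ij) (<⇒≤ i<j)))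
              ∷ (λ _ _ (ij , _ , ik) → notAscending ij (ascending ik))
              ∷ (λ _ _ (ij , _ , ik) → notAscending ik (ascending ij)) ∷ []
  ; clauses   = (1-32 ∷ 13-2 ∷ []) ∷ (2-13 ∷ 21-3 ∷ []) ∷ (2-31 ∷ 23-1 ∷ []) ∷ []
  ; classify  = classify
  }
  where
  R : ℕ → ℕ → ℕ → Set
  R c i j = c ≤ i

  classify : ∀ {N w} → WordDistinct N w → All (Any (WordAvoids N w)) _ →
             ∃[ c ] c ≤ N × WordRealizes N (R c) w
  classify {N} {w} distinct (a132 ∷ a213 ∷ a231 ∷ []) = c , c≤N , realizes
    where
    open WordOrder distinct
    open FirstAscent distinct

    -- A descent right after an ascent makes the three letters 132 or 231, so ascents propagate from
    -- `c` onward.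
    after : ∀ {i} → c ≤ i → suc i ≤ N → w i < w (suc i)
    after {i} c≤i 1+i≤N with m≤n⇒m<n∨m≡n c≤i
    ... | inj₂ refl = ascent 1+i≤N
    after {suc i} _ 2+i≤N | inj₁ (s≤s c≤i) = ≯⇒< ≤-refl 2+i≤N noDescent
      where
      p : w i < w (suc i)
      p = after c≤i (<⇒≤ 2+i≤N)
      noDescent : ¬ (w (2 + i) < w (suc i))
      noDescent q with compare {i} {2 + i} (m<n⇒m<1+n ≤-refl) 2+i≤N
      ... | inj₁ r = avoidsConsecutive a132 2+i≤N (isomorphic (up p) (down q) (up r))
      ... | inj₂ r = avoidsConsecutive a231 2+i≤N (isomorphic (up p) (down q) (down r))

    -- Induction on `k`: a rise of `w (suc k)` above `w i` would give 2-13 at `i, k, suc k` and 21-3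
    -- at `i, suc i, suc k`.
    below : ∀ {i k} → i < c → c ≤ k → k ≤ N → w k < w i
    below {i} {k} i<c c≤k k≤N with m≤n⇒m<n∨m≡n c≤k
    ... | inj₂ refl = before i<c ≤-refl
    below {i} {suc k} i<c _ 1+k≤N | inj₁ (s≤s c≤k) =
      ≮⇒> (m<n⇒m<1+n i<k) 1+k≤N (no213 a213)
      where
      i<k : i < k
      i<k = ≤-trans i<c c≤k
      no213 : Any (WordAvoids N w) (2-13 ∷ 21-3 ∷ []) → ¬ (w i < w (suc k))
      no213 (here avoids) p =
        avoids i<k 1+k≤N
          (isomorphic (down (below i<c c≤k (<⇒≤ 1+k≤N))) (up (after c≤k 1+k≤N)) (up p))
      no213 (there (here avoids)) p =
        avoids (s≤s i<k) 1+k≤N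
          (isomorphic (down (descent i<c)) (up (<-trans (descent i<c) p)) (up p))

    realizes : WordRealizes N (R c) w
    realizes {i} {j} i<j j≤N with c ≤? i
    ... | yes c≤i = both (chain _<_ <-trans w after c≤i i<j j≤N) c≤i
    ... | no c≰i with j ≤? c
    ...   | yes j≤c = neither (<-asym (before i<j j≤c)) c≰i
    ...   | no j≰c  = neither (<-asym (below (≰⇒> c≰i) (<⇒≤ (≰⇒> j≰c)) j≤N)) c≰i

families : List Family
families = largeFirst ∷ smallInserted ∷ twoDescents ∷ finalAscents ∷ []

-- Enumerating the avoiders of a pattern set

-- The first half makes every permutation of the family avoid `P`; the second puts every avoider of
-- `P` into the family.
Fits : Family → List GenPattern → Set
Fits F P = All (λ p → underlying p ∈ Family.words F) P
         × All (Any (_∈ P)) (Family.clauses F)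

-- Passing between permutations and words

module _ {N : ℕ} where

  toℕ-mod : ∀ {i} → i ≤ N → toℕ (i mod suc N) ≡ i
  toℕ-mod i≤N = trans (Fin.toℕ-fromℕ< _) (m≤n⇒m%n≡m i≤N)

  mod-toℕ : (i : Fin (suc N)) → toℕ i mod suc N ≡ i
  mod-toℕ i = Fin.toℕ-injective (toℕ-mod (Fin.toℕ≤pred[n] i))

  mod-mono-< : ∀ {i j} → i < j → j ≤ N → (i mod suc N) Fin.< (j mod suc N)
  mod-mono-< i<j j≤N =
    subst₂ _<_ (sym (toℕ-mod (≤-trans (<⇒≤ i<j) j≤N))) (sym (toℕ-mod j≤N)) i<j

  toℕ-mod-suc : ∀ {i} → suc i ≤ N → toℕ (suc i mod suc N) ≡ suc (toℕ (i mod suc N))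
  toℕ-mod-suc 1+i≤N = trans (toℕ-mod 1+i≤N) (cong suc (sym (toℕ-mod (<⇒≤ 1+i≤N))))

module _ {N : ℕ} (π : Permutation′ (suc N)) where

  -- Positions past N are junk: they wrap around.
  word : ℕ → ℕ
  word i = toℕ (π ⟨$⟩ʳ (i mod suc N))

  word-distinct : WordDistinct N word
  word-distinct i<j j≤N eq =
    Fin.<⇒≢ (mod-mono-< i<j j≤N) (⟨$⟩ʳ-injective π (Fin.toℕ-injective eq))

  avoids⇒wordAvoids : ∀ p → Avoids π p → WordAvoids N word p
  avoids⇒wordAvoids (dash₁ _) avoids i<j 1+j≤N iso =
    avoids (_ , _ , _ , mod-mono-< i<j (<⇒≤ 1+j≤N) , toℕ-mod-suc 1+j≤N , iso)
  avoids⇒wordAvoids (dash₂ _) avoids 1+i<k k≤N iso =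
    avoids (_ , _ , _ , toℕ-mod-suc (≤-trans (<⇒≤ 1+i<k) k≤N) , mod-mono-< 1+i<k k≤N , iso)

  wordRealizes⇒realizes : ∀ {R} → WordRealizes N R word → Realizes R π
  wordRealizes⇒realizes {R} wR {i} {j} i<j =
    subst₂ (λ x y → (π ⟨$⟩ʳ x Fin.< π ⟨$⟩ʳ y) ⇔ R (toℕ i) (toℕ j)) (mod-toℕ i) (mod-toℕ j)
      (wR i<j (Fin.toℕ≤pred[n] j))

realizes⇒shape : ∀ {n} R abc (π : Permutation′ n) → Realizes R π → ∀ {i j k} →
  i Fin.< j → j Fin.< k → OrderIsomorphic (subword π i j k) abc →
  Shape R (toℕ i) (toℕ j) (toℕ k) abc
realizes⇒shape R abc π πR i<j j<k iso =
  via (πR i<j) (iso 0F 1F) , via (πR j<k) (iso 1F 2F) , via (πR (<-trans i<j j<k)) (iso 0F 2F)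
  where
  via : ∀ {P Q T : Set} → P ⇔ Q → P ⇔ T → Q ⇔ T
  via e f = mk⇔ (to f ∘ from e) (to e ∘ from f)

-- Adjacent positions are in particular increasing, so an occurrence of either dashed form is an
-- occurrence of the underlying word.
excludes⇒avoids : ∀ {n} R (π : Permutation′ n) → Realizes R π →
  ∀ p → Excludes R (underlying p) → Avoids π p
excludes⇒avoids R π πR (dash₁ abc) excl (_ , j , k , i<j , jk , iso) =
  excl i<j j<k (realizes⇒shape R abc π πR i<j j<k iso)
  where
  j<k : j Fin.< k
  j<k = ≤-reflexive (sym jk)
excludes⇒avoids R π πR (dash₂ abc) excl (i , j , _ , ij , j<k , iso) =
  excl i<j j<k (realizes⇒shape R abc π πR i<j j<k iso)
  where
  i<j : i Fin.< j
  i<j = ≤-reflexive (sym ij)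

-- The bijection between avoiders and parameters

module _ (F : Family) where

  open Family F

  -- Pointwise equal permutations would force `R c` and `R d` to agree on the separating pair, which
  -- lies within the positions as `d ≤ N`.
  realizes-unseparated : ∀ {N c d} (π σ : Permutation′ (suc N)) → π ≈ σ → d ≤ N →
                         Realizes (R c) π → Realizes (R d) σ → ¬ (c < d)
  realizes-unseparated {N} {c} {d} π σ π≈σ d≤N πR σR c<d with separates c<d
  ... | i , j , i<j , j≤d , differ =
    differ (subst₂ (λ x y → R c x y ⇔ R d x y) (toℕ-mod i≤N) (toℕ-mod j≤N)
                   (mk⇔ (to σR′ ∘ from πR′) (to πR′ ∘ from σR′)))
    where
    j≤N : j ≤ N
    j≤N = ≤-trans j≤d d≤N
    i≤N : i ≤ N
    i≤N = ≤-trans (<⇒≤ i<j) j≤N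
    i′<j′ : (i mod suc N) Fin.< (j mod suc N)
    i′<j′ = mod-mono-< i<j j≤N
    πR′ = πR i′<j′
    σR′ = subst₂ (λ x y → (x Fin.< y) ⇔ R d (toℕ (i mod suc N)) (toℕ (j mod suc N)))
                 (sym (π≈σ _)) (sym (π≈σ _)) (σR i′<j′)

  realizes-parameter : ∀ {N} {c d : Fin (suc N)} (π σ : Permutation′ (suc N)) → π ≈ σ →
    Realizes (R (toℕ c)) π → Realizes (R (toℕ d)) σ → c ≡ d
  realizes-parameter {c = c} {d} π σ π≈σ πR σR with Fin.<-cmp c d
  ... | tri≈ _ c≡d _ = c≡d
  ... | tri< c<d _ _ = contradiction c<d
    (realizes-unseparated π σ π≈σ (Fin.toℕ≤pred[n] d) πR σR)
  ... | tri> _ _ d<c = contradiction d<c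
    (realizes-unseparated σ π (sym ∘ π≈σ) (Fin.toℕ≤pred[n] c) σR πR)

  module _ {P : List GenPattern} (fits : Fits F P) (N : ℕ) where

    parameter : (π : Permutation′ (suc N)) → All (Avoids π) P →
                ∃[ c ] Realizes {suc N} (R (toℕ {suc N} c)) π
    parameter π avoids = let (c , c≤N , wR) = classify (word-distinct π) wordAvoids in
      fromℕ< (s≤s c≤N) ,
      subst (λ d → Realizes (R d) π) (sym (Fin.toℕ-fromℕ< (s≤s c≤N))) (wordRealizes⇒realizes π wR)
      where
      wordAvoids : All (Any (WordAvoids N (word π))) clauses
      wordAvoids = All.map (Any.map (λ {p} p∈P → avoids⇒wordAvoids π p (All.lookup avoids p∈P)))
                           (proj₂ fits)

    module Canonical (c : Fin (suc N)) =
      Realization (R? (toℕ c)) (R-trans {toℕ c}) (R-cotrans {toℕ c})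

    canonical : Fin (suc N) → Permutation′ (suc N)
    canonical c = Canonical.realization c

    canonical-realizes : ∀ c → Realizes (R (toℕ c)) (canonical c)
    canonical-realizes c = Canonical.realization-realizes c

    canonical-avoids : ∀ c → All (Avoids (canonical c)) P
    canonical-avoids c = All.map
      (λ {p} p∈words → excludes⇒avoids (R (toℕ c)) (canonical c) (canonical-realizes c) p
                         (All.lookup excludes p∈words))
      (proj₁ fits)

    fits⇒cardinality : HasCardinality (S (suc N) P) (suc N)
    fits⇒cardinality = record
      { to        = λ (π , avoids) → proj₁ (parameter π avoids)
      ; from      = λ c → canonical c , canonical-avoids c
      ; to-cong   = λ { {π , πA} {σ , σA} π≈σ →
                        realizes-parameter π σ π≈σ (proj₂ (parameter π πA))
                                                   (proj₂ (parameter σ σA)) }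
      ; from-cong = λ { refl _ → refl }
      -- First, a permutation equal to the canonical one for `c` has parameter `c`. Second, an
      -- avoider and the canonical permutation of its parameter realize the same relation, hence
      -- coincide.
      ; inverse   =
          (λ { {c} {π , πA} π≈ →
               realizes-parameter π (canonical c) π≈ (proj₂ (parameter π πA))
                                                     (canonical-realizes c) })
        , (λ { {π , πA} refl →
               let (c , πR) = parameter π πA in
               realizes-unique (R (toℕ c)) (canonical c) π (canonical-realizes c) πR })
      }

-- Matching the pattern sets with the families

_≟ᵛ_ : DecidableEquality (Vec ℕ 3)
_≟ᵛ_ = ≡-dec _≟_

_≟ᵖ_ : DecidableEquality GenPattern
dash₁ u ≟ᵖ dash₁ v = map′ (cong dash₁) (λ { refl → refl }) (u ≟ᵛ v)
dash₂ u ≟ᵖ dash₂ v = map′ (cong dash₂) (λ { refl → refl }) (u ≟ᵛ v)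
dash₁ _ ≟ᵖ dash₂ _ = no (λ ())
dash₂ _ ≟ᵖ dash₁ _ = no (λ ())

fits? : ∀ F P → Dec (Fits F P)
fits? F P = All.all? (λ p → underlying p ∈ᵛ? Family.words F) P
      ×-dec All.all? (Any.any? (_∈ᵖ? P)) (Family.clauses F)
  where
  open DecMembership _≟ᵛ_ renaming (_∈?_ to _∈ᵛ?_)
  open DecMembership _≟ᵖ_ renaming (_∈?_ to _∈ᵖ?_)

-- All twenty cases are settled by evaluating the decision procedure, which finds a family for each
-- set.
patternSets-fit : All (λ P → Any (λ F → Fits F P) families) patternSets
patternSets-fit = from-yes (All.all? (λ P → Any.any? (λ F → fits? F P) families) patternSets)

fitsSome⇒cardinality : ∀ {P} → Any (λ F → Fits F P) families →
                       (n : ℕ) → n ≥ 1 → HasCardinality (S n P) n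
-- Length `suc N` matches the `suc N` parameters from 0 to `N`.
fitsSome⇒cardinality fitsSome (suc N) _ with Any.satisfied fitsSome
... | F , fits = fits⇒cardinality F fits N

mainTheorem15 : All (λ P → (n : ℕ) → n ≥ 1 → HasCardinality (S n P) n) patternSets
mainTheorem15 = All.map fitsSome⇒cardinality patternSets-fit
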